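{- $\mathrm{MSO}[\le,\mathrm{Arb}_1]$ has the Crane Beach property: every language $L\subseteq A^*$ definable in $\mathrm{MSO}[\le,\mathrm{Arb}_1]$ that has a neutral letter is definable in $\mathrm{MSO}[\le]$, i.e. is regular.
   Context: A monadic predicate is $\mathbf{P}=(\mathbf{P}_n)_n$ with $\mathbf{P}_n\subseteq\{0,\ldots,n-1\}$ (arbitrary); $\mathrm{Arb}_1$ is the class of all of them. $L\in\mathrm{MSO}[\le,\mathrm{Arb}_1]$ means $L=\{u\in A^*\mid u,\mathbf{P}_1,\ldots,\mathbf{P}_\ell\models\varphi\}$ for an MSO sentence $\varphi$ over letter predicates, $\le$ and monadic predicate symbols $P_j$ (with $P_j(x)$ holding on a word of length $n$ iff $x\in(\mathbf{P}_j)_n$) and some monadic predicates $\mathbf{P}_j$. A letter $e\in A$ is neutral for $L$ if for all words $u,v$: $uv\in L\Leftrightarrow uev\in L$. -}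

module Defs where

open import Data.Nat using (ℕ; zero; suc)
open import Data.Fin using (Fin; zero; suc; _≤_)
open import Data.Fin.Subset using (Subset; _∈_)
open import Data.List using (List; length; lookup; _++_; _∷_)
open import Data.Product using (Σ; ∃; _×_; _,_)
open import Data.Sum using (_⊎_)
open import Relation.Nullary using (¬_)
open import Relation.Binary.PropositionalEquality using (_≡_)
open import Function.Bundles using (_⇔_)

Word : ℕ → Set
Word k = List (Fin k)

Language : ℕ → Set₁
Language k = Word k → Set

MonadicPredicate : Set
MonadicPredicate = (n : ℕ) → Subset n

-- MSO formulas over alphabet Fin k, with ℓ monadic predicate symbols,
-- m free first-order and M free second-order variables (de Bruijn indices).
data Formula (k ℓ : ℕ) : ℕ → ℕ → Set where
  letter : ∀ {m M} → Fin k → Fin m → Formula k ℓ m M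
  leq    : ∀ {m M} → Fin m → Fin m → Formula k ℓ m M
  pred   : ∀ {m M} → Fin ℓ → Fin m → Formula k ℓ m M
  mem    : ∀ {m M} → Fin m → Fin M → Formula k ℓ m M
  neg    : ∀ {m M} → Formula k ℓ m M → Formula k ℓ m M
  and    : ∀ {m M} → Formula k ℓ m M → Formula k ℓ m M → Formula k ℓ m M
  or     : ∀ {m M} → Formula k ℓ m M → Formula k ℓ m M → Formula k ℓ m M
  ex1    : ∀ {m M} → Formula k ℓ (suc m) M → Formula k ℓ m M
  ex2    : ∀ {m M} → Formula k ℓ m (suc M) → Formula k ℓ m M
  all1   : ∀ {m M} → Formula k ℓ (suc m) M → Formula k ℓ m M
  all2   : ∀ {m M} → Formula k ℓ m (suc M) → Formula k ℓ m M

Sentence : ℕ → ℕ → Set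
Sentence k ℓ = Formula k ℓ zero zero

extend : ∀ {A : Set} {m} → A → (Fin m → A) → Fin (suc m) → A
extend a ρ zero = a
extend a ρ (suc i) = ρ i

Sat : ∀ {k ℓ m M} (u : Word k) → (Fin ℓ → MonadicPredicate) →
      (Fin m → Fin (length u)) → (Fin M → Subset (length u)) →
      Formula k ℓ m M → Set
Sat u Ps ρ σ (letter a x) = lookup u (ρ x) ≡ a
Sat u Ps ρ σ (leq x y)    = ρ x ≤ ρ y
Sat u Ps ρ σ (pred j x)   = ρ x ∈ Ps j (length u)
Sat u Ps ρ σ (mem x X)    = ρ x ∈ σ X
Sat u Ps ρ σ (neg φ)      = ¬ Sat u Ps ρ σ φ
Sat u Ps ρ σ (and φ ψ)    = Sat u Ps ρ σ φ × Sat u Ps ρ σ ψ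
Sat u Ps ρ σ (or φ ψ)     = Sat u Ps ρ σ φ ⊎ Sat u Ps ρ σ ψ
Sat u Ps ρ σ (ex1 φ)      = Σ (Fin (length u)) λ p → Sat u Ps (extend p ρ) σ φ
Sat u Ps ρ σ (ex2 φ)      = Σ (Subset (length u)) λ S → Sat u Ps ρ (extend S σ) φ
Sat u Ps ρ σ (all1 φ)     = (p : Fin (length u)) → Sat u Ps (extend p ρ) σ φ
Sat u Ps ρ σ (all2 φ)     = (S : Subset (length u)) → Sat u Ps ρ (extend S σ) φ

private
  noVar : ∀ {A : Set} → Fin zero → A
  noVar ()

_⊨_,_ : ∀ {k ℓ} → Word k → (Fin ℓ → MonadicPredicate) → Sentence k ℓ → Set
u ⊨ Ps , φ = Sat u Ps noVar noVar φ

DefinableMSOArb1 : ∀ {k} → Language k → Set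
DefinableMSOArb1 {k} L =
  Σ ℕ λ ℓ → Σ (Sentence k ℓ) λ φ → Σ (Fin ℓ → MonadicPredicate) λ Ps →
    (u : Word k) → L u ⇔ (u ⊨ Ps , φ)

DefinableMSO : ∀ {k} → Language k → Set
DefinableMSO {k} L =
  Σ (Sentence k zero) λ φ → (u : Word k) → L u ⇔ (u ⊨ noVar , φ)

NeutralLetter : ∀ {k} → Language k → Fin k → Set
NeutralLetter L e = ∀ u v → L (u ++ v) ⇔ L (u ++ e ∷ v)

HasNeutralLetter : ∀ {k} → Language k → Set
HasNeutralLetter {k} L = Σ (Fin k) λ e → NeutralLetter L e

{-# OPTIONS --safe #-}

-- By the composition method, for a fixed length n and a fixed cut of {0,…,n-1}, the truth of φ
-- on a word depends on its prefix only through one of finitely many types, whose number N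
-- depends neither on n nor on the monadic predicates.  A neutral letter allows padding any
-- prefixes and suffixes to common lengths, so at most N words are pairwise distinguishable by
-- L, and L is regular by Myhill–Nerode.
--
-- Constructively, Nerode equivalence is decidable because it coincides with agreement on
-- suffixes of length at most N: if two words first disagree on a longer suffix, then the
-- bounded equivalences are strictly refined at each earlier length as well, which yields more
-- than N separated words.
module Submission where

open import Defs
open import Data.Bool using (Bool; true; false)
open import Data.Bool.Properties using () renaming (_≟_ to _≟ᵇ_)
open import Data.Fin as Fin
  using (Fin; zero; suc; _↑ˡ_; _↑ʳ_; toℕ; fromℕ; inject₁; funToFin; combine)
open import Data.Fin.Induction using (<-weakInduction)
open import Data.Fin.Properties
  using (any?; all?; combine-injective; finToFun-funToFin; subst-is-cast;
         splitAt⁻¹-↑ˡ; splitAt⁻¹-↑ʳ; toℕ-↑ˡ; toℕ-↑ʳ; toℕ<n; pigeonhole; ¬∀⟶∃¬;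
         toℕ-inject₁; ≤fromℕ; ≤-antisym)
  renaming (_≟_ to _≟ᶠ_; _≤?_ to _≤ᶠ?_)
open import Data.Fin.Subset using (Subset; _∈_)
open import Data.Fin.Subset.Properties using (_∈?_; anySubset?)
open import Data.List as List using (List; []; _∷_; length; foldl; reverse; _ʳ++_)
import Data.List.Properties as List
open import Data.Maybe using (Maybe; just; nothing)
open import Data.Nat using (ℕ; zero; suc; _+_; _*_; _^_; _⊔_; _≤_; _<_; z≤n; s≤s)
open import Data.Nat.Properties
  using (≤-refl; ≤-reflexive; ≤-trans; <⇒≤; <⇒≱; <-≤-trans; <-irrefl; ≮⇒≥; ≰⇒>; ≤-pred;
         ≤-<-connex; m≤m+n; m≤m⊔n; m≤n⊔m; +-suc; +-comm)
open import Data.Product using (Σ; ∃; ∃₂; _×_; _,_; proj₁; proj₂)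
open import Data.Product.Function.NonDependent.Propositional using (_×-⇔_)
open import Data.Sum as Sum using (_⊎_; inj₁; inj₂)
open import Data.Sum.Function.Propositional using (_⊎-⇔_)
open import Data.Vec as Vec using (Vec; []; _∷_; _++_)
open import Data.Vec.Properties
  using (lookup-++ˡ; lookup-++ʳ; length-toList; toList-++; []=⇒lookup; lookup⇒[]=; lookup∘tabulate)
open import Function using (_∘_; id)
open import Function.Bundles using (_⇔_; mk⇔; Equivalence)
open import Function.Construct.Composition using (_⇔-∘_)
open import Function.Construct.Symmetry using (⇔-sym)
open import Function.Related.Propositional using (equivalence; module EquationalReasoning)
open import Function.Related.TypeIsomorphisms using (¬-cong-⇔)
open import Relation.Nullary using (¬_; Dec; yes; no; contradiction; does)
open import Relation.Nullary.Decidable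
  using (map; map′; ¬?; does-⇔; _×-dec_; _⊎-dec_; decidable-stable; dec-true)
open import Relation.Binary.PropositionalEquality using (_≡_; _≗_; refl; sym; trans; cong; cong₂; subst)

open Equivalence using (to; from)

-- Satisfaction: change of domain and decidability

∃-cong-⇔ : {A : Set} {B C : A → Set} → (∀ x → B x ⇔ C x) → Σ A B ⇔ Σ A C
∃-cong-⇔ h = mk⇔ (λ (x , b) → x , to (h x) b) (λ (x , c) → x , from (h x) c)

∀-cong-⇔ : {A : Set} {B C : A → Set} → (∀ x → B x ⇔ C x) → (∀ x → B x) ⇔ (∀ x → C x)
∀-cong-⇔ h = mk⇔ (λ f x → to (h x) (f x)) (λ f x → from (h x) (f x))

≡⇒⇔ : {A B : Set} → A ≡ B → A ⇔ B
≡⇒⇔ refl = mk⇔ id id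

extend-cong : ∀ {A : Set} {m} {ρ ρ' : Fin m → A} (a : A) → ρ ≗ ρ' → extend a ρ ≗ extend a ρ'
extend-cong a h zero    = refl
extend-cong a h (suc x) = h x

-- Satisfaction over an abstract domain Fin n, so that n can be a sum i + j.
Holds : ∀ {k ℓ m M n} → (Fin n → Fin k) → (Fin ℓ → Subset n) →
        (Fin m → Fin n) → (Fin M → Subset n) → Formula k ℓ m M → Set
Holds w P ρ σ (letter a x)   = w (ρ x) ≡ a
Holds w P ρ σ (leq x y)      = ρ x Fin.≤ ρ y
Holds w P ρ σ (pred c x)     = ρ x ∈ P c
Holds w P ρ σ (mem x X)      = ρ x ∈ σ X
Holds w P ρ σ (neg φ)        = ¬ Holds w P ρ σ φ
Holds w P ρ σ (and φ ψ)      = Holds w P ρ σ φ × Holds w P ρ σ ψ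
Holds w P ρ σ (or φ ψ)       = Holds w P ρ σ φ ⊎ Holds w P ρ σ ψ
Holds {n = n} w P ρ σ (ex1 φ)  = Σ (Fin n) λ p → Holds w P (extend p ρ) σ φ
Holds {n = n} w P ρ σ (ex2 φ)  = Σ (Subset n) λ S → Holds w P ρ (extend S σ) φ
Holds {n = n} w P ρ σ (all1 φ) = (p : Fin n) → Holds w P (extend p ρ) σ φ
Holds {n = n} w P ρ σ (all2 φ) = (S : Subset n) → Holds w P ρ (extend S σ) φ

Holds? : ∀ {k ℓ m M n} (w : Fin n → Fin k) (P : Fin ℓ → Subset n)
         (ρ : Fin m → Fin n) (σ : Fin M → Subset n) (φ : Formula k ℓ m M) → Dec (Holds w P ρ σ φ)
Holds? w P ρ σ (letter a x) = w (ρ x) ≟ᶠ a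
Holds? w P ρ σ (leq x y)    = ρ x ≤ᶠ? ρ y
Holds? w P ρ σ (pred c x)   = ρ x ∈? P c
Holds? w P ρ σ (mem x X)    = ρ x ∈? σ X
Holds? w P ρ σ (neg φ)      = ¬? (Holds? w P ρ σ φ)
Holds? w P ρ σ (and φ ψ)    = Holds? w P ρ σ φ ×-dec Holds? w P ρ σ ψ
Holds? w P ρ σ (or φ ψ)     = Holds? w P ρ σ φ ⊎-dec Holds? w P ρ σ ψ
Holds? w P ρ σ (ex1 φ)      = any? λ p → Holds? w P (extend p ρ) σ φ
Holds? w P ρ σ (ex2 φ)      = anySubset? λ S → Holds? w P ρ (extend S σ) φ
Holds? w P ρ σ (all1 φ)     = all? λ p → Holds? w P (extend p ρ) σ φ
-- Decided as the absence of a counterexample; `decidable-stable` removes the double negation.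
Holds? w P ρ σ (all2 φ)     = map′
  (λ none S → decidable-stable (Holds? w P ρ (extend S σ) φ) λ ¬h → none (S , ¬h))
  (λ h (S , ¬h) → ¬h (h S))
  (¬? (anySubset? λ S → ¬? (Holds? w P ρ (extend S σ) φ)))

module _ {k ℓ} (u : Word k) (Ps : Fin ℓ → MonadicPredicate)
         {w : Fin (length u) → Fin k} (w≗ : List.lookup u ≗ w) where

  Sat⇔Holds : ∀ {m M} {ρ ρ' : Fin m → Fin (length u)} {σ σ' : Fin M → Subset (length u)} →
    ρ ≗ ρ' → σ ≗ σ' → (φ : Formula k ℓ m M) →
    Sat u Ps ρ σ φ ⇔ Holds w (λ c → Ps c (length u)) ρ' σ' φ
  Sat⇔Holds r s (letter a x) = ≡⇒⇔ (cong (_≡ a) (trans (w≗ _) (cong w (r x))))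
  Sat⇔Holds r s (leq x y)    = ≡⇒⇔ (cong₂ Fin._≤_ (r x) (r y))
  Sat⇔Holds r s (pred c x)   = ≡⇒⇔ (cong (_∈ Ps c (length u)) (r x))
  Sat⇔Holds r s (mem x X)    = ≡⇒⇔ (cong₂ _∈_ (r x) (s X))
  Sat⇔Holds r s (neg φ)      = ¬-cong-⇔ (Sat⇔Holds r s φ)
  Sat⇔Holds r s (and φ ψ)    = Sat⇔Holds r s φ ×-⇔ Sat⇔Holds r s ψ
  Sat⇔Holds r s (or φ ψ)     = Sat⇔Holds r s φ ⊎-⇔ Sat⇔Holds r s ψ
  Sat⇔Holds r s (ex1 φ)      = ∃-cong-⇔ λ p → Sat⇔Holds (extend-cong p r) s φ
  Sat⇔Holds r s (ex2 φ)      = ∃-cong-⇔ λ S → Sat⇔Holds r (extend-cong S s) φ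
  Sat⇔Holds r s (all1 φ)     = ∀-cong-⇔ λ p → Sat⇔Holds (extend-cong p r) s φ
  Sat⇔Holds r s (all2 φ)     = ∀-cong-⇔ λ S → Sat⇔Holds r (extend-cong S s) φ

lookup-toList : ∀ {A : Set} {n} (xs : Vec A n) (p : Fin (length (Vec.toList xs))) →
  List.lookup (Vec.toList xs) p ≡ Vec.lookup xs (Fin.cast (length-toList xs) p)
lookup-toList (x ∷ xs) zero    = refl
lookup-toList (x ∷ xs) (suc p) = lookup-toList xs p

noFin : ∀ {A : Set} → Fin 0 → A
noFin ()

Sat-toList⇔Holds : ∀ {k ℓ n} (xs : Vec (Fin k) n) (Ps : Fin ℓ → MonadicPredicate) {ρ σ}
  (φ : Sentence k ℓ) →
  Sat (Vec.toList xs) Ps ρ σ φ ⇔ Holds (Vec.lookup xs) (λ c → Ps c n) noFin noFin φ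
Sat-toList⇔Holds {k} {ℓ} xs Ps φ = transport (Vec.toList xs) (length-toList xs) λ p →
  trans (lookup-toList xs p) (cong (Vec.lookup xs) (sym (subst-is-cast (length-toList xs) p)))
  where
  -- For an arbitrary list the length equation can be matched with `refl`; for `length-toList xs`
  -- itself it cannot.
  transport : ∀ u {n} (eq : length u ≡ n) {w : Fin n → Fin k} →
    (∀ p → List.lookup u p ≡ w (subst Fin eq p)) → ∀ {ρ σ} →
    Sat u Ps ρ σ φ ⇔ Holds w (λ c → Ps c n) noFin noFin φ
  transport u refl w≗ = Sat⇔Holds u Ps w≗ (λ ()) (λ ()) φ

-- Types of prefixes

indicator : ∀ {A : Set} → Dec A → Fin 2
indicator (yes _) = zero
indicator (no _)  = suc zero

indicator-≡⇒→ : ∀ {A B : Set} (A? : Dec A) (B? : Dec B) → indicator A? ≡ indicator B? → A → B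
indicator-≡⇒→ A?      (yes b) _  _ = b
indicator-≡⇒→ (no ¬a) (no _)  _  a = contradiction a ¬a
indicator-≡⇒→ (yes _) (no _)  ()

-- A subset of `Fin n` as a number, so that a set of types is again an element of some `Fin`.
code : ∀ {n} {Q : Fin n → Set} → (∀ t → Dec (Q t)) → Fin (2 ^ n)
code Q? = funToFin (indicator ∘ Q?)

code-≡⇒→ : ∀ {n} {Q R : Fin n → Set} (Q? : ∀ t → Dec (Q t)) (R? : ∀ t → Dec (R t)) →
  code Q? ≡ code R? → ∀ t → Q t → R t
code-≡⇒→ Q? R? eq t = indicator-≡⇒→ (Q? t) (R? t)
  (trans (sym (finToFun-funToFin (indicator ∘ Q?) t))
    (trans (cong (λ c → Fin.finToFun c t) eq) (finToFun-funToFin (indicator ∘ R?) t)))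

-- "nothing" stands for all the positions beyond the prefix.
positionImage : ∀ {i n} → (Maybe (Fin i) → Fin n) → Fin (2 ^ n * n)
positionImage f = combine (code λ t → any? λ q → f (just q) ≟ᶠ t) (f nothing)

subsetImage : ∀ {i n} → (Subset i → Fin n) → Fin (2 ^ n)
subsetImage f = code λ t → anySubset? λ S → f S ≟ᶠ t

module _ {i i' n} (f : Maybe (Fin i) → Fin n) (f' : Maybe (Fin i') → Fin n)
         (eq : positionImage f ≡ positionImage f') where

  private
    parts-≡ = combine-injective (code λ t → any? λ q → f (just q) ≟ᶠ t) (f nothing) _ _ eq

  positionImage-just : ∀ q → ∃ λ q' → f' (just q') ≡ f (just q)
  positionImage-just q =
    code-≡⇒→ (λ t → any? λ q → f (just q) ≟ᶠ t) (λ t → any? λ q → f' (just q) ≟ᶠ t)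
      (proj₁ parts-≡) (f (just q)) (q , refl)

  positionImage-nothing : f' nothing ≡ f nothing
  positionImage-nothing = sym (proj₂ parts-≡)

subsetImage-match : ∀ {i i' n} (f : Subset i → Fin n) (f' : Subset i' → Fin n) →
  subsetImage f ≡ subsetImage f' → ∀ S → ∃ λ S' → f' S' ≡ f S
subsetImage-match f f' eq S =
  code-≡⇒→ (λ t → anySubset? λ S → f S ≟ᶠ t) (λ t → anySubset? λ S → f' S ≟ᶠ t) eq (f S) (S , refl)

-- A function of the formula alone: the length, the cut and the monadic predicates do not enter,
-- which makes the final bound uniform.
typeCount : ∀ {k ℓ m M} → Formula k ℓ m M → ℕ
typeCount (letter a x) = 2
typeCount (leq x y)    = 2
typeCount (pred c x)   = 2
typeCount (mem x X)    = 2
typeCount (neg φ)      = typeCount φ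
typeCount (and φ ψ)    = typeCount φ * typeCount ψ
typeCount (or φ ψ)     = typeCount φ * typeCount ψ
typeCount (ex1 φ)      = 2 ^ typeCount φ * typeCount φ
typeCount (ex2 φ)      = 2 ^ typeCount φ
typeCount (all1 φ)     = 2 ^ typeCount φ * typeCount φ
typeCount (all2 φ)     = 2 ^ typeCount φ

-- The composition method at a fixed cut

module Composition {k ℓ i j : ℕ} (P : Fin ℓ → Subset (i + j)) where

  -- Once an argument lies beyond the prefix, the cut and the common suffix settle the atom, so
  -- `zero` is a dummy value here and in `atType`.
  leqType : Maybe (Fin i) → Maybe (Fin i) → Fin 2
  leqType (just q) (just r) = indicator (q ≤ᶠ? r)
  leqType _        _        = zero

  atType : ∀ {Q : Fin i → Set} → (∀ q → Dec (Q q)) → Maybe (Fin i) → Fin 2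
  atType Q? (just q) = indicator (Q? q)
  atType Q? nothing  = zero

  -- A Hintikka type that follows the syntax of φ. Both kinds of quantifier record which types of
  -- the body are realised, and this determines either of them.
  type : ∀ {m M} → Vec (Fin k) i → (Fin m → Maybe (Fin i)) → (Fin M → Subset i) →
         (φ : Formula k ℓ m M) → Fin (typeCount φ)
  type p ρ σ (letter a x) = atType (λ q → Vec.lookup p q ≟ᶠ a) (ρ x)
  type p ρ σ (leq x y)    = leqType (ρ x) (ρ y)
  type p ρ σ (pred c x)   = atType (λ q → q ↑ˡ j ∈? P c) (ρ x)
  type p ρ σ (mem x X)    = atType (λ q → q ∈? σ X) (ρ x)
  type p ρ σ (neg φ)      = type p ρ σ φ
  type p ρ σ (and φ ψ)    = combine (type p ρ σ φ) (type p ρ σ ψ)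
  type p ρ σ (or φ ψ)     = combine (type p ρ σ φ) (type p ρ σ ψ)
  type p ρ σ (ex1 φ)      = positionImage λ q → type p (extend q ρ) σ φ
  type p ρ σ (ex2 φ)      = subsetImage λ S → type p ρ (extend S σ) φ
  type p ρ σ (all1 φ)     = positionImage λ q → type p (extend q ρ) σ φ
  type p ρ σ (all2 φ)     = subsetImage λ S → type p ρ (extend S σ) φ

  -- The first two indices are the traces on the two prefixes of values in the two
  -- glued structures, which coincide on the common suffix.
  data Position : Maybe (Fin i) → Maybe (Fin i) → Fin (i + j) → Fin (i + j) → Set where
    inside  : ∀ q q' → Position (just q) (just q') (q ↑ˡ j) (q' ↑ˡ j)
    outside : ∀ r → Position nothing nothing (i ↑ʳ r) (i ↑ʳ r)

  data Glued : Subset i → Subset i → Subset (i + j) → Subset (i + j) → Set where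
    glue : ∀ S S' T → Glued S S' (S ++ T) (S' ++ T)

  position-sym : ∀ {a b c d} → Position a b c d → Position b a d c
  position-sym (inside q q') = inside q' q
  position-sym (outside r)   = outside r

  glued-sym : ∀ {a b c d} → Glued a b c d → Glued b a d c
  glued-sym (glue S S' T) = glue S' S T

  extend-rel : ∀ {A B : Set} {R : A → A → B → B → Set} {n a b c d}
    {f g : Fin n → A} {f' g' : Fin n → B} →
    R a b c d → (∀ x → R (f x) (g x) (f' x) (g' x)) →
    ∀ x → R (extend a f x) (extend b g x) (extend c f' x) (extend d g' x)
  extend-rel r rs zero    = r
  extend-rel r rs (suc x) = rs x

  -- The answering move of an Ehrenfeucht-Fraïssé game: a prefix position is answered through the
  -- equal images, a suffix position by itself.
  match-position : ∀ {n} (f f' : Maybe (Fin i) → Fin n) → positionImage f ≡ positionImage f' →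
    ∀ c → ∃ λ c' → ∃₂ λ a a' → Position a a' c c' × f a ≡ f' a'
  match-position f f' eq c with Fin.splitAt i c in split
  ... | inj₁ q with refl ← splitAt⁻¹-↑ˡ {i = c} split =
    let q' , e = positionImage-just f f' eq q in q' ↑ˡ j , _ , _ , inside q q' , sym e
  ... | inj₂ r with refl ← splitAt⁻¹-↑ʳ {i = c} split =
    i ↑ʳ r , _ , _ , outside r , sym (positionImage-nothing f f' eq)

  match-subset : ∀ {n} (f f' : Subset i → Fin n) → subsetImage f ≡ subsetImage f' →
    ∀ S → ∃ λ S' → ∃₂ λ a a' → Glued a a' S S' × f a ≡ f' a'
  match-subset f f' eq S with Vec.splitAt i S
  ... | S₁ , S₂ , refl =
    let S₁' , e = subsetImage-match f f' eq S₁ in S₁' ++ S₂ , _ , _ , glue S₁ S₁' S₂ , sym e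

  transfer-at : {Q Q' : Fin i → Set} {F F' : Fin (i + j) → Set}
    (Q? : ∀ q → Dec (Q q)) (Q'? : ∀ q → Dec (Q' q)) →
    (∀ q → F (q ↑ˡ j) → Q q) → (∀ q → Q' q → F' (q ↑ˡ j)) → (∀ r → F (i ↑ʳ r) → F' (i ↑ʳ r)) →
    ∀ {a a' c c'} → Position a a' c c' → atType Q? a ≡ atType Q'? a' → F c → F' c'
  transfer-at Q? Q'? F→Q Q'→F' F→F' (inside q q') eq =
    Q'→F' q' ∘ indicator-≡⇒→ (Q? q) (Q'? q') eq ∘ F→Q q
  transfer-at Q? Q'? F→Q Q'→F' F→F' (outside r) eq = F→F' r

  -- Only a comparison within the prefix consults the type: prefix positions precede all suffix
  -- positions, and suffix positions do not change.
  transfer-leq : ∀ {a a' b b' c c' d d'} → Position a a' c c' → Position b b' d d' →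
    leqType a b ≡ leqType a' b' → c Fin.≤ d → c' Fin.≤ d'
  transfer-leq (inside q q') (inside r r') eq
    rewrite toℕ-↑ˡ q j | toℕ-↑ˡ q' j | toℕ-↑ˡ r j | toℕ-↑ˡ r' j =
    indicator-≡⇒→ (q ≤ᶠ? r) (q' ≤ᶠ? r') eq
  transfer-leq (inside q q') (outside r) eq _
    rewrite toℕ-↑ˡ q' j | toℕ-↑ʳ i r = ≤-trans (<⇒≤ (toℕ<n q')) (m≤m+n i (toℕ r))
  transfer-leq (outside r) (inside q q') eq le
    rewrite toℕ-↑ˡ q j | toℕ-↑ʳ i r =
    contradiction (<-≤-trans (toℕ<n q) (≤-trans (m≤m+n i (toℕ r)) le)) (<-irrefl refl)
  transfer-leq (outside r) (outside r') eq le = le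

  transfer-mem : ∀ {a a' c c' A A' C C'} → Position a a' c c' → Glued A A' C C' →
    atType (_∈? A) a ≡ atType (_∈? A') a' → c ∈ C → c' ∈ C'
  transfer-mem pos (glue S S' T) = transfer-at {F = _∈ S ++ T} {F' = _∈ S' ++ T} (_∈? S) (_∈? S')
    (λ q h → lookup⇒[]= q S (trans (sym (lookup-++ˡ S T q)) ([]=⇒lookup h)))
    (λ q h → lookup⇒[]= _ (S' ++ T) (trans (lookup-++ˡ S' T q) ([]=⇒lookup h)))
    (λ r h → lookup⇒[]= _ (S' ++ T)
      (trans (lookup-++ʳ S' T r) (trans (sym (lookup-++ʳ S T r)) ([]=⇒lookup h))))
    pos

  -- Induction on φ. One implication for all pairs of prefixes is enough, because negation exchanges
  -- the two prefixes.
  transfer : ∀ {m M} (φ : Formula k ℓ m M) (p p' : Vec (Fin k) i) (v : Vec (Fin k) j)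
    {ρ ρ' : Fin m → Maybe (Fin i)} {σ σ' : Fin M → Subset i} {R R' S S'} →
    (∀ x → Position (ρ x) (ρ' x) (R x) (R' x)) → (∀ X → Glued (σ X) (σ' X) (S X) (S' X)) →
    type p ρ σ φ ≡ type p' ρ' σ' φ →
    Holds (Vec.lookup (p ++ v)) P R S φ → Holds (Vec.lookup (p' ++ v)) P R' S' φ
  transfer (letter a x) p p' v pos sub eq = transfer-at
    {F = λ c → Vec.lookup (p ++ v) c ≡ a} {F' = λ c → Vec.lookup (p' ++ v) c ≡ a} _ _
    (λ q → trans (sym (lookup-++ˡ p v q))) (λ q → trans (lookup-++ˡ p' v q))
    (λ r h → trans (lookup-++ʳ p' v r) (trans (sym (lookup-++ʳ p v r)) h)) (pos x) eq
  transfer (leq x y) p p' v pos sub eq = transfer-leq (pos x) (pos y) eq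
  transfer (pred c x) p p' v pos sub eq =
    transfer-at {F = _∈ P c} {F' = _∈ P c} _ _ (λ _ → id) (λ _ → id) (λ _ → id) (pos x) eq
  transfer (mem x X) p p' v pos sub eq = transfer-mem (pos x) (sub X) eq
  transfer (neg φ) p p' v pos sub eq h =
    h ∘ transfer φ p' p v (position-sym ∘ pos) (glued-sym ∘ sub) (sym eq)
  transfer (and φ ψ) p p' v pos sub eq (h , h') =
    let e , e' = combine-injective (type p _ _ φ) (type p _ _ ψ) _ _ eq in
    transfer φ p p' v pos sub e h , transfer ψ p p' v pos sub e' h'
  transfer (or φ ψ) p p' v pos sub eq =
    let e , e' = combine-injective (type p _ _ φ) (type p _ _ ψ) _ _ eq in
    Sum.map (transfer φ p p' v pos sub e) (transfer ψ p p' v pos sub e')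
  transfer (ex1 φ) p p' v {ρ} {ρ'} {σ} {σ'} pos sub eq (c , h) =
    let c' , _ , _ , new , e = match-position (λ x → type p (extend x ρ) σ φ)
          (λ x → type p' (extend x ρ') σ' φ) eq c in
    c' , transfer φ p p' v (extend-rel {R = Position} new pos) sub e h
  transfer (ex2 φ) p p' v {ρ} {ρ'} {σ} {σ'} pos sub eq (C , h) =
    let C' , _ , _ , new , e = match-subset (λ x → type p ρ (extend x σ) φ)
          (λ x → type p' ρ' (extend x σ') φ) eq C in
    C' , transfer φ p p' v pos (extend-rel {R = Glued} new sub) e h
  -- The challenge `c'` comes from the second structure, so the game is played backwards.
  transfer (all1 φ) p p' v {ρ} {ρ'} {σ} {σ'} pos sub eq h c' =
    let c , _ , _ , new , e = match-position (λ x → type p' (extend x ρ') σ' φ)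
          (λ x → type p (extend x ρ) σ φ) (sym eq) c' in
    transfer φ p p' v (extend-rel {R = Position} (position-sym new) pos) sub (sym e) (h c)
  transfer (all2 φ) p p' v {ρ} {ρ'} {σ} {σ'} pos sub eq h C' =
    let C , _ , _ , new , e = match-subset (λ x → type p' ρ' (extend x σ') φ)
          (λ x → type p ρ (extend x σ) φ) (sym eq) C' in
    transfer φ p p' v pos (extend-rel {R = Glued} (glued-sym new) sub) (sym e) (h C)

  same-type : (φ : Sentence k ℓ) {p p' : Vec (Fin k) i} (v : Vec (Fin k) j) →
    type p noFin noFin φ ≡ type p' noFin noFin φ →
    Holds (Vec.lookup (p ++ v)) P noFin noFin φ ⇔ Holds (Vec.lookup (p' ++ v)) P noFin noFin φ
  same-type φ {p} {p'} v eq =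
    mk⇔ (transfer φ p p' v (λ ()) (λ ()) eq) (transfer φ p' p v (λ ()) (λ ()) (sym eq))

-- Padding with the neutral letter

∂ : ∀ {k} → Fin k → Language k → Language k
∂ a L u = L (a ∷ u)

-- Truncates words longer than n.
pad : ∀ {k} → Fin k → (n : ℕ) → Word k → Vec (Fin k) n
pad e zero    u       = []
pad e (suc n) []      = e ∷ pad e n []
pad e (suc n) (a ∷ u) = a ∷ pad e n u

-- Letters already passed are absorbed into the derivative `∂ a L`, for which `e` is again neutral.
-- The contexts `x` and `y` allow padding a suffix behind a prefix and a prefix before a suffix.
pad-neutral : ∀ {k} (L : Language k) {e} → NeutralLetter L e → ∀ x u y {n} → length u ≤ n →
  L (x List.++ u List.++ y) ⇔ L (x List.++ Vec.toList (pad e n u) List.++ y)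
pad-neutral L N (a ∷ x) u y le = pad-neutral (∂ a L) (N ∘ (a ∷_)) x u y le
pad-neutral L N [] [] y {zero} le = mk⇔ id id
pad-neutral L N [] [] y {suc n} le =
  pad-neutral (∂ _ L) (N ∘ (_ ∷_)) [] [] y z≤n ⇔-∘ N [] y
pad-neutral L N [] (a ∷ u) y (s≤s le) = pad-neutral (∂ a L) (N ∘ (a ∷_)) [] u y le

bounded : ∀ {n} (f : Fin n → ℕ) → ∃ λ b → ∀ x → f x ≤ b
bounded {zero}  f = 0 , λ ()
bounded {suc n} f =
  let b , h = bounded (f ∘ suc) in
  f zero ⊔ b , λ { zero → m≤m⊔n (f zero) b ; (suc x) → ≤-trans (h x) (m≤n⊔m (f zero) b) }

-- The bound on the suffixes makes the statement constructive: padding needs a common length,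
-- and the indistinguishable pair found depends on it.
FiniteIndex : ∀ {k} → Language k → ℕ → Set
FiniteIndex {k} L N = ∀ {n} → N < n → (us : Fin n → Word k) (d : ℕ) →
  ∃₂ λ x y → x Fin.< y ×
    (∀ v → length v ≤ d → L (us x List.++ v) ⇔ L (us y List.++ v))

-- With prefixes padded to a common bound `i` and suffixes to `d`, all words have length `i + d` and
-- see the same predicates; the pigeonhole principle then gives two prefixes of equal type.
definable⇒finiteIndex : ∀ {k} (L : Language k) {e} → NeutralLetter L e →
  ((_ , φ , _) : DefinableMSOArb1 L) → FiniteIndex L (typeCount φ)
definable⇒finiteIndex {k} L {e} neutral (ℓ , φ , Ps , def) N<n us d =
  let x , y , x<y , eq = pigeonhole N<n λ x → type (pad e i (us x)) noFin noFin φ in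
  x , y , x<y , λ v v≤d →
    L (us x List.++ v)  ∼⟨ padded x v v≤d ⟩
    _                   ∼⟨ same-type φ (pad e d v) eq ⟩
    _                   ∼⟨ ⇔-sym (padded y v v≤d) ⟩
    L (us y List.++ v)  ∎
  where
  open EquationalReasoning {k = equivalence}
  i = proj₁ (bounded (length ∘ us))
  open Composition {j = d} (λ c → Ps c (i + d))
  padded : ∀ x v → length v ≤ d → L (us x List.++ v) ⇔
    Holds (Vec.lookup (pad e i (us x) ++ pad e d v)) (λ c → Ps c (i + d)) noFin noFin φ
  padded x v v≤d =
    L (us x List.++ v)                  ≡⟨ cong (L ∘ (us x List.++_)) (List.++-identityʳ v) ⟨
    L (us x List.++ v List.++ [])       ∼⟨ pad-neutral L neutral (us x) v [] v≤d ⟩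
    L (us x List.++ v' List.++ [])      ≡⟨ cong (L ∘ (us x List.++_)) (List.++-identityʳ v') ⟩
    L (us x List.++ v')
      ∼⟨ pad-neutral L neutral [] (us x) v' (proj₂ (bounded (length ∘ us)) x) ⟩
    L (Vec.toList p List.++ v')         ≡⟨ cong L (toList-++ p (pad e d v)) ⟨
    L (Vec.toList (p ++ pad e d v))     ∼⟨ def _ ⟩
    _                                   ∼⟨ Sat-toList⇔Holds (p ++ pad e d v) Ps φ ⟩
    Holds (Vec.lookup (p ++ pad e d v)) (λ c → Ps c (i + d)) noFin noFin φ ∎
    where
    p  = pad e i (us x)
    v' = Vec.toList (pad e d v)

-- Minimal automata

record Automaton (k : ℕ) : Set where
  field
    {states} : ℕ
    start    : Fin states
    step     : Fin states → Fin k → Fin states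
    final    : Fin states → Bool

  accepts : Word k → Bool
  accepts u = final (foldl step start u)

module Nerode {k : ℕ} (b : Word k → Bool) where

  -- Prefixes are stored reversed, so that reading one more letter is consing.
  Agree : ℕ → Word k → Word k → Set
  Agree zero    x y = b (x ʳ++ []) ≡ b (y ʳ++ [])
  Agree (suc d) x y = b (x ʳ++ []) ≡ b (y ʳ++ []) × ∀ a → Agree d (a ∷ x) (a ∷ y)

  Agree? : ∀ d x y → Dec (Agree d x y)
  Agree? zero    x y = b (x ʳ++ []) ≟ᵇ b (y ʳ++ [])
  Agree? (suc d) x y =
    (b (x ʳ++ []) ≟ᵇ b (y ʳ++ [])) ×-dec all? (λ a → Agree? d (a ∷ x) (a ∷ y))

  Agree-sym : ∀ d {x y} → Agree d x y → Agree d y x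
  Agree-sym zero    e       = sym e
  Agree-sym (suc d) (e , h) = sym e , λ a → Agree-sym d (h a)

  Agree-trans : ∀ d {x y z} → Agree d x y → Agree d y z → Agree d x z
  Agree-trans zero    e       e'        = trans e e'
  Agree-trans (suc d) (e , h) (e' , h') = trans e e' , λ a → Agree-trans d (h a) (h' a)

  Agree-[] : ∀ d {x y} → Agree d x y → b (x ʳ++ []) ≡ b (y ʳ++ [])
  Agree-[] zero    e       = e
  Agree-[] (suc d) (e , _) = e

  Agree-pred : ∀ d {x y} → Agree (suc d) x y → Agree d x y
  Agree-pred zero    (e , _) = e
  Agree-pred (suc d) (e , h) = e , λ a → Agree-pred d (h a)

  Agree-intro : ∀ d {x y} → (∀ v → length v ≤ d → b (x ʳ++ v) ≡ b (y ʳ++ v)) → Agree d x y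
  Agree-intro zero    h = h [] z≤n
  Agree-intro (suc d) h = h [] z≤n , λ a → Agree-intro d λ v le → h (a ∷ v) (s≤s le)

  Separated : ∀ d {n} → (Fin n → Word k) → Set
  Separated d r = ∀ i j → Agree d (r i) (r j) → i ≡ j

  extend-separated : ∀ d {n z} {r : Fin n → Word k} → (∀ i → ¬ Agree d z (r i)) →
    Separated d r → Separated d (extend z r)
  extend-separated d fresh sep zero    zero    _ = refl
  extend-separated d fresh sep zero    (suc j) e = contradiction e (fresh j)
  extend-separated d fresh sep (suc i) zero    e = contradiction (Agree-sym d e) (fresh i)
  extend-separated d fresh sep (suc i) (suc j) e = cong suc (sep i j e)

  -- The depth-d class split at depth d + 1 by x and y contains at most one r i,
  -- which disagrees with x or with y.
  separate-more : ∀ d x y → Agree d x y → ¬ Agree (suc d) x y →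
    ∀ {n} (r : Fin n → Word k) → Separated d r →
    ∃ λ (r' : Fin (suc n) → Word k) → Separated (suc d) r'
  separate-more d x y agree split r sep with any? (λ i → Agree? d x (r i))
  ... | no fresh = extend x r , extend-separated (suc d) (λ i e → fresh (i , Agree-pred d e))
                         (λ i j → sep i j ∘ Agree-pred d)
  ... | yes (i , xᵢ) = choose (Agree? (suc d) x (r i))
    where
    add : ∀ z → Agree d z (r i) → ¬ Agree (suc d) z (r i) → Separated (suc d) (extend z r)
    add z zᵢ ¬zᵢ = extend-separated (suc d) fresh (λ i j → sep i j ∘ Agree-pred d)
      where
      fresh : ∀ j → ¬ Agree (suc d) z (r j)
      fresh j zⱼ with refl ← sep i j (Agree-trans d (Agree-sym d zᵢ) (Agree-pred d zⱼ)) = ¬zᵢ zⱼ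
    choose : Dec (Agree (suc d) x (r i)) → ∃ (Separated (suc d))
    choose (no ¬xᵢ) = extend x r , add x xᵢ ¬xᵢ
    choose (yes xᵢ') = extend y r , add y (Agree-trans d (Agree-sym d agree) xᵢ)
      λ yᵢ → split (Agree-trans (suc d) xᵢ' (Agree-sym (suc d) yᵢ))

  -- If agreement first fails at depth `2 + d`, then after some letter it first fails at depth
  -- `1 + d`. Starting from a single word, each of the `1 + d` levels adds one separated word.
  split⇒separated : ∀ d x y → Agree d x y → ¬ Agree (suc d) x y →
    ∃ λ (r : Fin (2 + d) → Word k) → Separated (suc d) r
  split⇒separated zero x y agree split =
    separate-more 0 x y agree split (λ _ → x) λ { zero zero _ → refl }
  split⇒separated (suc d) x y agree split =
    let a , split' = ¬∀⟶∃¬ k _ (λ a → Agree? (suc d) (a ∷ x) (a ∷ y))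
                       λ h → split (Agree-[] (suc d) agree , h)
        r , sep = split⇒separated d (a ∷ x) (a ∷ y) (proj₂ agree a) split'
    in separate-more (suc d) x y agree split r sep

  module _ {N} (bound : ∀ {n d} (r : Fin n → Word k) → Separated d r → n ≤ N) where

    -- A split at depth `suc N` would give `2 + N` separated words.
    stable : ∀ {x y} → Agree N x y → Agree (suc N) x y
    stable {x} {y} agree = decidable-stable (Agree? (suc N) x y) λ split →
      let r , sep = split⇒separated N x y agree split in
      <-irrefl refl (<⇒≤ (bound r sep))

    -- Reading a letter costs one level of agreement, which `stable` restores.
    equivalent : ∀ {x y} → Agree N x y → ∀ v → b (x ʳ++ v) ≡ b (y ʳ++ v)
    equivalent agree []      = Agree-[] N agree
    equivalent agree (a ∷ v) = equivalent (proj₂ (stable agree) a) v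

    Recognisable : Set
    Recognisable = Σ (Automaton k) λ A → ∀ u → b u ≡ Automaton.accepts A u

    successor? : ∀ {n} (r : Fin n → Word k) i a → Dec (∃ λ j → Agree N (a ∷ r i) (r j))
    successor? r i a = any? λ j → Agree? N (a ∷ r i) (r j)

    Closed : ∀ {n} → (Fin n → Word k) → Set
    Closed r = ∀ i a → ∃ λ j → Agree N (a ∷ r i) (r j)

    -- The indices of the representatives are the states. Replacing `a ∷ r i` by its representative
    -- changes no later answer, by `equivalent`.
    closed⇒recognisable : ∀ {n} (r : Fin n → Word k) (i : Fin n) → r i ≡ [] → Closed r →
      Recognisable
    closed⇒recognisable r i root closed =
      A , λ u → trans (cong (λ x → b (x ʳ++ u)) (sym root)) (run i u)
      where
      A : Automaton k
      A = record { start = i ; step = λ i a → proj₁ (closed i a) ; final = λ i → b (r i ʳ++ []) }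
      open Automaton A
      run : ∀ i u → b (r i ʳ++ u) ≡ final (foldl step i u)
      run i []      = refl
      run i (a ∷ u) = trans (equivalent (proj₂ (closed i a)) u) (run (step i a) u)

    -- There are at most N pairwise separated words, so N + 1 - n bounds the remaining steps.
    saturate : ∀ fuel {n} (r : Fin n → Word k) → Separated N r → N < fuel + n →
      (i : Fin n) → r i ≡ [] → Recognisable
    saturate zero       r sep N<n i root = contradiction (bound r sep) (<⇒≱ N<n)
    saturate (suc fuel) {n} r sep N<n i root
      with all? (λ i → all? (successor? r i))
    ... | yes closed = closed⇒recognisable r i root closed
    ... | no ¬closed =
      let i' , h = ¬∀⟶∃¬ n _ (λ i → all? (successor? r i)) ¬closed
          a , fresh = ¬∀⟶∃¬ k _ (successor? r i') h
      in saturate fuel (extend (a ∷ r i') r) (extend-separated N (λ j e → fresh (j , e)) sep)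
           (subst (N <_) (sym (+-suc fuel n)) N<n) (suc i) root

    recognisable : Recognisable
    recognisable = saturate N {1} (λ _ → []) (λ { zero zero _ → refl })
      (≤-reflexive (+-comm 1 N)) zero refl

finiteIndex⇒recognisable : ∀ {k} (L : Language k) (L? : ∀ u → Dec (L u)) {N} → FiniteIndex L N →
  Σ (Automaton k) λ A → ∀ u → does (L? u) ≡ Automaton.accepts A u
finiteIndex⇒recognisable {k} L L? {N} finite = recognisable bound
  where
  open Nerode (does ∘ L?)
  bound : ∀ {n d} (r : Fin n → Word k) → Separated d r → n ≤ N
  bound {n} {d} r sep = ≮⇒≥ λ N<n →
    -- `Nerode` stores prefixes reversed, whereas `FiniteIndex` speaks of them in reading order.
    let x , y , x<y , same = finite N<n (reverse ∘ r) d in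
    <-irrefl (cong toℕ (sep x y (Agree-intro d λ v le →
      trans (cong (does ∘ L?) (List.ʳ++-defn (r x)))
        (trans (does-⇔ (same v le) (L? _) (L? _)) (cong (does ∘ L?) (sym (List.ʳ++-defn (r y)))))))) x<y

-- A sentence describing the runs of an automaton

imp : ∀ {k ℓ m M} → Formula k ℓ m M → Formula k ℓ m M → Formula k ℓ m M
imp φ ψ = or (neg φ) ψ

-- `imp` is a disjunction, so proving it constructively requires deciding the premise.
imp⁺ : {P Q : Set} → Dec P → (P → Q) → ¬ P ⊎ Q
imp⁺ (yes p) h = inj₂ (h p)
imp⁺ (no ¬p) h = inj₁ ¬p

imp⁻ : {P Q : Set} → ¬ P ⊎ Q → P → Q
imp⁻ (inj₁ ¬p) p = contradiction p ¬p
imp⁻ (inj₂ q)  _ = q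

-- The formulas have no truth constants; the universal sentence chosen is true on the empty word as
-- well.
⟦_⟧ : ∀ {k ℓ m M} → Bool → Formula k ℓ m M
⟦ true ⟧  = all1 (leq zero zero)
⟦ false ⟧ = neg (all1 (leq zero zero))

⋀ : ∀ {k ℓ m M} n → (Fin n → Formula k ℓ m M) → Formula k ℓ m M
⋀ zero    φ = ⟦ true ⟧
⋀ (suc n) φ = and (φ zero) (⋀ n (φ ∘ suc))

exs : ∀ {k ℓ m} M → Formula k ℓ m M → Formula k ℓ m 0
exs zero    φ = φ
exs (suc M) φ = exs M (ex2 φ)

module _ {k ℓ} (u : Word k) (Ps : Fin ℓ → MonadicPredicate) where

  Sat? : ∀ {m M} (ρ : Fin m → Fin (length u)) (σ : Fin M → Subset (length u))
         (φ : Formula k ℓ m M) → Dec (Sat u Ps ρ σ φ)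
  Sat? ρ σ φ = map (⇔-sym (Sat⇔Holds u Ps (λ _ → refl) (λ _ → refl) (λ _ → refl) φ))
                   (Holds? (List.lookup u) _ ρ σ φ)

  module _ {m M} {ρ : Fin m → Fin (length u)} {σ : Fin M → Subset (length u)} where

    private
      Satisfied : Formula k ℓ m M → Set
      Satisfied = Sat u Ps ρ σ

    ⟦⟧⁺ : ∀ {b} → b ≡ true → Satisfied ⟦ b ⟧
    ⟦⟧⁺ refl p = ≤-refl

    ⟦⟧⁻ : ∀ b → Satisfied ⟦ b ⟧ → b ≡ true
    ⟦⟧⁻ true  _ = refl
    ⟦⟧⁻ false h = contradiction (λ p → ≤-refl) h

    ⋀⁺ : ∀ n φ → (∀ i → Satisfied (φ i)) → Satisfied (⋀ n φ)
    ⋀⁺ zero    φ h = ⟦⟧⁺ refl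
    ⋀⁺ (suc n) φ h = h zero , ⋀⁺ n (φ ∘ suc) (h ∘ suc)

    ⋀⁻ : ∀ n φ → Satisfied (⋀ n φ) → ∀ i → Satisfied (φ i)
    ⋀⁻ (suc n) φ (h , hs) zero    = h
    ⋀⁻ (suc n) φ (h , hs) (suc i) = ⋀⁻ n (φ ∘ suc) hs i

  -- The environment built by iterated `extend` equals `τ` only pointwise, hence the premise for
  -- every such `σ`.
  exs⁺ : ∀ {m} M (φ : Formula k ℓ m M) {ρ σ₀} (τ : Fin M → Subset (length u)) →
    (∀ {σ} → σ ≗ τ → Sat u Ps ρ σ φ) → Sat u Ps ρ σ₀ (exs M φ)
  exs⁺ zero    φ τ h = h λ ()
  exs⁺ (suc M) φ τ h = exs⁺ M (ex2 φ) (τ ∘ suc) λ σ≗ →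
    τ zero , h λ { zero → refl ; (suc X) → σ≗ X }

  exs⁻ : ∀ {m} M (φ : Formula k ℓ m M) {ρ σ₀} → Sat u Ps ρ σ₀ (exs M φ) → ∃ λ σ → Sat u Ps ρ σ φ
  exs⁻ zero    φ h = _ , h
  exs⁻ (suc M) φ h = let _ , S , h' = exs⁻ M (ex2 φ) h in _ , h'

module _ {k} (A : Automaton k) where

  open Automaton A

  -- The letter at the given position has been read.
  stateAt : Fin states → (u : Word k) → Fin (length u) → Fin states
  stateAt q (a ∷ u) zero    = step q a
  stateAt q (a ∷ u) (suc p) = stateAt (step q a) u p

  stateAt-suc : ∀ q a u (p : Fin (length u)) →
    stateAt q (a ∷ u) (suc p) ≡ step (stateAt q (a ∷ u) (inject₁ p)) (List.lookup u p)
  stateAt-suc q a (b ∷ u) zero    = refl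
  stateAt-suc q a (b ∷ u) (suc p) = stateAt-suc (step q a) b u p

  stateAt-last : ∀ q a u → stateAt q (a ∷ u) (fromℕ (length u)) ≡ foldl step q (a ∷ u)
  stateAt-last q a []      = refl
  stateAt-last q a (b ∷ u) = stateAt-last (step q a) b u

  one : ∀ {n} → Fin (2 + n)
  one = suc zero

  first last : ∀ {M} → Formula k 0 1 M
  first = all1 (leq one zero)
  last  = all1 (leq zero one)

  -- Variable zero covers variable one.
  covers : ∀ {M} → Formula k 0 2 M
  covers = and (neg (leq zero one)) (all1 (or (leq zero (suc one)) (leq one zero)))

  initialBody : Fin k → Formula k 0 1 states
  initialBody a = imp (letter a zero) (mem zero (step start a))

  nextBody : Fin states → Fin k → Formula k 0 2 states
  nextBody q a = imp (and (mem one q) (letter a zero)) (mem zero (step q a))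

  finalBody : Fin states → Formula k 0 1 states
  finalBody q = imp (mem zero q) ⟦ final q ⟧

  -- On the empty word the other three conjuncts hold vacuously, so `nonempty` alone must decide
  -- acceptance there.
  nonempty initial next final' body : Formula k 0 0 states
  nonempty = or ⟦ final start ⟧ (ex1 ⟦ true ⟧)
  initial  = all1 (imp first (⋀ k initialBody))
  next     = all1 (all1 (imp covers (⋀ states λ q → ⋀ k (nextBody q))))
  final'   = all1 (imp last (⋀ states finalBody))
  body     = and nonempty (and initial (and next final'))

  -- The sets X_q are only required to contain the positions at which the run is in
  -- state q; disjointness is not needed.
  runSentence : Sentence k 0
  runSentence = exs states body

  module _ (Ps : Fin 0 → MonadicPredicate) where

    -- By induction along the positions, each lies in the set of the state reached there; at the
    -- last position `final'` makes that state accepting.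
    body⇒accepts : ∀ u {ρ σ} → Sat u Ps ρ σ body → accepts u ≡ true
    body⇒accepts []      (inj₁ h , _) = ⟦⟧⁻ [] Ps (final start) h
    body⇒accepts (a ∷ u) {ρ} {σ} (_ , init , nxt , fin) =
      trans (cong final (sym (stateAt-last start a u)))
        (⟦⟧⁻ w Ps (final q) (imp⁻
          (⋀⁻ w Ps states finalBody (imp⁻ (fin _) ≤fromℕ) q)
          (run (fromℕ (length u)))))
      where
      w = a ∷ u
      q = stateAt start w (fromℕ (length u))
      run : ∀ p → p ∈ σ (stateAt start w p)
      run = <-weakInduction _
        (imp⁻
          (⋀⁻ w Ps k initialBody (imp⁻ (init zero) λ _ → z≤n) a) refl)
        λ p ih →
          let q' = stateAt start w (inject₁ p)
              b = List.lookup u p in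
          subst (λ q → suc p ∈ σ q) (sym (stateAt-suc start a u p))
            (imp⁻
              (⋀⁻ w Ps k (nextBody q') (⋀⁻ w Ps states (λ q → ⋀ k (nextBody q))
                (imp⁻ (nxt (inject₁ p) (suc p))
                  (adjacent p)) q') b)
              (ih , refl))
        where
        adjacent : ∀ {n} (p : Fin n) →
          ¬ (suc p Fin.≤ inject₁ p) × (∀ (z : Fin (suc n)) → z Fin.≤ inject₁ p ⊎ suc p Fin.≤ z)
        adjacent p rewrite toℕ-inject₁ p = <-irrefl refl , λ z → ≤-<-connex (toℕ z) (toℕ p)

    module _ (u : Word k) where

      runSets : Fin states → Subset (length u)
      runSets q = Vec.tabulate λ p → does (stateAt start u p ≟ᶠ q)

      ∈-runSets⁺ : ∀ {p q} → stateAt start u p ≡ q → p ∈ runSets q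
      ∈-runSets⁺ {p} {q} eq =
        lookup⇒[]= p _ (trans (lookup∘tabulate _ p) (dec-true (stateAt start u p ≟ᶠ q) eq))

      ∈-runSets⁻ : ∀ {p q} → p ∈ runSets q → stateAt start u p ≡ q
      ∈-runSets⁻ {p} {q} h with stateAt start u p ≟ᶠ q | trans (sym (lookup∘tabulate _ p)) ([]=⇒lookup h)
      ... | yes eq | _  = eq
      ... | no _   | ()

    accepts⇒body : ∀ u {ρ σ} → σ ≗ runSets u → accepts u ≡ true → Sat u Ps ρ σ body
    accepts⇒body [] {ρ} {σ} σ≗ acc = inj₁ (⟦⟧⁺ [] Ps acc) , (λ ()) , (λ ()) , (λ ())
    accepts⇒body (a ∷ u) {ρ} {σ} σ≗ acc =
      inj₂ (zero , λ _ → ≤-refl) ,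
      (λ x → imp⁺ (Sat? w Ps (extend x ρ) σ first) λ x≤ →
        ⋀⁺ w Ps k initialBody λ b → imp⁺ (_ ≟ᶠ b) (init x x≤ b)) ,
      (λ x y → imp⁺ (Sat? w Ps (extend y (extend x ρ)) σ covers) λ c →
        ⋀⁺ w Ps states (λ q → ⋀ k (nextBody q)) λ q → ⋀⁺ w Ps k (nextBody q) λ b →
          imp⁺ ((x ∈? σ q) ×-dec (_ ≟ᶠ b)) (nxt x y c q b)) ,
      λ x → imp⁺ (Sat? w Ps (extend x ρ) σ last) λ ≤x →
        ⋀⁺ w Ps states finalBody λ q → imp⁺ (x ∈? σ q) (fin x ≤x q)
      where
      w = a ∷ u
      ∈⁺ : ∀ {p q} → stateAt start w p ≡ q → p ∈ σ q
      ∈⁺ {p} {q} eq = subst (p ∈_) (sym (σ≗ q)) (∈-runSets⁺ w eq)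
      ∈⁻ : ∀ {p q} → p ∈ σ q → stateAt start w p ≡ q
      ∈⁻ {p} {q} h = ∈-runSets⁻ w (subst (p ∈_) (σ≗ q) h)
      init : ∀ x → (∀ z → x Fin.≤ z) → ∀ b → List.lookup w x ≡ b → x ∈ σ (step start b)
      init zero    x≤ b refl = ∈⁺ refl
      init (suc x) x≤ b _    = contradiction (x≤ zero) λ ()
      nxt : ∀ x y → ¬ (y Fin.≤ x) × (∀ z → z Fin.≤ x ⊎ y Fin.≤ z) → ∀ q b →
        x ∈ σ q × List.lookup w y ≡ b → y ∈ σ (step q b)
      nxt x zero    (y≰x , _) q b _ = contradiction z≤n y≰x
      nxt x (suc y) (y≰x , between) q b (x∈ , refl) = ∈⁺
        (trans (stateAt-suc start a u y) (cong (λ q → step q b)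
          (trans (cong (stateAt start w) (sym x≡)) (∈⁻ x∈))))
        where
        x≡ : x ≡ inject₁ y
        -- The predecessor of `suc y` lies below it, so it is at most `x`; conversely `x` lies
        -- strictly below `suc y`.
        x≡ with between (inject₁ y)
        ... | inj₁ le = ≤-antisym (subst (toℕ x ≤_) (sym (toℕ-inject₁ y)) (≤-pred (≰⇒> y≰x))) le
        ... | inj₂ lt = contradiction (subst (toℕ y <_) (toℕ-inject₁ y) lt) (<-irrefl refl)
      fin : ∀ x → (∀ z → z Fin.≤ x) → ∀ q → x ∈ σ q → Sat w Ps (extend x ρ) σ ⟦ final q ⟧
      fin x ≤x q x∈ = ⟦⟧⁺ w Ps (trans (cong final (trans (sym (∈⁻ x∈))
        (trans (cong (stateAt start w) (≤-antisym (≤fromℕ x) (≤x _))) (stateAt-last start a u)))) acc)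

    accepts⇔Sat : ∀ u {ρ σ} → accepts u ≡ true ⇔ Sat u Ps ρ σ runSentence
    accepts⇔Sat u = mk⇔
      (λ acc → exs⁺ u Ps states body (runSets u) λ σ≗ → accepts⇒body u σ≗ acc)
      (λ h → body⇒accepts u (proj₂ (exs⁻ u Ps states body h)))

mainTheorem12 : (k : ℕ) (L : Language k) →
    DefinableMSOArb1 L → HasNeutralLetter L → DefinableMSO L
mainTheorem12 k L definable@(_ , φ , Ps , def) (e , neutral) =
  runSentence A , λ u → accepts⇔Sat A _ u ⇔-∘ subst (λ b → L u ⇔ b ≡ true) (A≡ u) (does⇔ (L? u))
  where
  L? : ∀ u → Dec (L u)
  -- However arbitrary the predicates, on each length they are finite subsets with decidable
  -- membership, so satisfaction on a word is decidable.
  L? u = map (⇔-sym (def u)) (Sat? u Ps _ _ φ)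
  does⇔ : ∀ {P : Set} (P? : Dec P) → P ⇔ does P? ≡ true
  does⇔ (yes p) = mk⇔ (λ _ → refl) (λ _ → p)
  does⇔ (no ¬p) = mk⇔ (λ p → contradiction p ¬p) λ ()
  recognised = finiteIndex⇒recognisable L L? (definable⇒finiteIndex L neutral definable)
  A = proj₁ recognised
  A≡ = proj₂ recognised
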